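{- Let $\Gamma$ be a finite constraint language over a finite domain $D$ and let $I=(X,D,C)$ be an instance of $\mathrm{CSP}(\Gamma)$ such that $\mathrm{BLP}(I)$ is feasible. Then $\mathrm{BLP}(I)$ has a feasible solution such that for every $x,x'\in X$ with $x\sim_\delta x'$ and every $d\in D$, $v(x,d)=v(x',d)$.
   Context: **CSP.** An instance of CSP is a triple $I=(X,D,C)$ with $X$ a finite set of variables, $D$ a finite domain, and $C$ a finite set of constraints; a constraint is a pair $c=(\mathbf{s}_c,R_c)$ with $R_c\subseteq D^k$ a relation of arity $k=arity(c)\ge 1$ and $\mathbf{s}_c$ (the scope) a $k$-tuple of variables. Write $x\in c$ if $x$ occurs in the scope of $c$. A constraint language $\Gamma$ is a set of relations over $D$; $\mathrm{CSP}(\Gamma)$ is the set of instances all of whose constraint relations lie in $\Gamma$. **Basic LP relaxation.** $\mathrm{BLP}(I)$ is the following linear feasibility problem. It has a variable $v(x,d)$ for each $x\in X$, $d\in D$, and a variable $v(c,\mathbf{t})$ for each $c\in C$ and $\mathbf{t}\in R_c$, all taking values in $[0,1]$, subject to $$\sum_{d\in D}v(x,d)=1\quad\text{for all }x\in X,$$ $$\sum_{\mathbf{t}\in R_c,\ \mathbf{t}[i]=d}v(c,\mathbf{t})-v(\mathbf{s}_c[i],d)=0\quad\text{for all }c\in C,\ i\in\{1,\dots,arity(c)\},\ d\in D.$$ **Iterated degree.** The factor graph $G_I$ of $I$ (not necessarily connected) is the bipartite graph with vertex set $X\cup C$ and edges $\{x,c\}$ for $x\in c$; the edge between $x$ and $c=(\mathbf{s},R)$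 has label $\ell_{x,c}=\ell_{c,x}=(S,R)$ where $S=\{i : \mathbf{s}[i]=x\}$. $N(v)$ is the neighbourhood of $v$ in $G_I$. Let $\delta_0$ be one fixed symbol on all variables and another, different fixed symbol on all constraints. For $k\ge 1$ and a node $v$, the $k$-th iterated degree $\delta_k(v)$ is the multiset $\{(\ell_{v,w},\delta_{k-1}(w)) : w\in N(v)\}$. Write $v\sim_\delta v'$ if $\delta_k(v)=\delta_k(v')$ for all $k\ge 0$. -}

module Defs where

open import Algebra.Bundles using (CommutativeRing)
open import Algebra.Definitions.RawMonoid using (sum)
open import Data.Bool using (if_then_else_)
open import Data.Fin using (Fin; finToFun; _≟_)
open import Data.Fin.Subset using (Subset) renaming (_∈_ to _∈ˢ_)
open import Data.Fin.Subset.Properties using () renaming (_∈?_ to _∈ˢ?_)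
open import Data.List using (List; map; filter; allFin)
import Data.List.Membership.Propositional as List
import Data.List.Relation.Binary.Permutation.Setoid as Permutation
open import Data.Nat using (ℕ; zero; suc; _^_; NonZero)
open import Data.Product using (Σ-syntax; ∃-syntax; _×_; _,_; map₂)
open import Data.Product.Relation.Binary.Pointwise.NonDependent using (_×ₛ_)
open import Data.Rational using (1/_; ≢-nonZero; nonNegative)
import Data.Rational as ℚ
import Data.Rational.Properties as ℚ
open import Data.Sum using (_⊎_; inj₁; inj₂)
open import Data.Vec using (Vec; lookup; tabulate)
import Data.Vec.Membership.DecPropositional as DecVec
open import Function using (Injective)
open import Level using (Level; 0ℓ) renaming (suc to lsuc; _⊔_ to _⊔ˡ_)
open import Relation.Binary using (Rel; Setoid; IsTotalOrder)
open import Relation.Binary.PropositionalEquality using (_≡_; setoid)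
open import Relation.Nullary using (¬_; does)
open import Relation.Nullary.Decidable using (_×-dec_)

-- There are no reals in the standard library.  The values of a linear
-- program range over an arbitrary ordered field, so that ℚ and the classical
-- real numbers are both covered.

record OrderedField (a ℓ₁ ℓ₂ : Level) : Set (lsuc (a ⊔ˡ ℓ₁ ⊔ˡ ℓ₂)) where
  field
    commutativeRing : CommutativeRing a ℓ₁
  open CommutativeRing commutativeRing public
  infix 4 _≤_
  field
    _≤_          : Rel Carrier ℓ₂
    0≉1          : ¬ (0# ≈ 1#)
    inverse      : ∀ x → ¬ (x ≈ 0#) → ∃[ y ] (x * y ≈ 1#)
    isTotalOrder : IsTotalOrder _≈_ _≤_
    +-monoˡ-≤    : ∀ z {x y} → x ≤ y → x + z ≤ y + z
    *-nonneg     : ∀ {x y} → 0# ≤ x → 0# ≤ y → 0# ≤ x * y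

ℚ-orderedField : OrderedField 0ℓ 0ℓ 0ℓ
ℚ-orderedField = record
  { commutativeRing = ℚ.+-*-commutativeRing
  ; _≤_             = ℚ._≤_
  ; 0≉1             = λ ()
  ; inverse         = λ x x≢0 → let instance _ = ≢-nonZero x≢0 in
                                1/ x , ℚ.*-inverseʳ x
  ; isTotalOrder    = ℚ.≤-isTotalOrder
  ; +-monoˡ-≤       = λ z x≤y → ℚ.+-monoˡ-≤ z x≤y
  ; *-nonneg        = λ {x} {y} 0≤x 0≤y →
      ℚ.nonNegative⁻¹ (x ℚ.* y)
        {{ℚ.nonNeg*nonNeg⇒nonNeg x {{nonNegative 0≤x}} y {{nonNegative 0≤y}}}}
  }

-- Finite sets are represented by Fin: the domain D is Fin d.
-- A k-tuple over D is given by its code in Fin (d ^ k), decoded by finToFun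
-- (a bijection, with inverse funToFin).  Subsets of D^k are then Subset (d ^ k),
-- for which _≡_ is extensional equality of relations.

Tuple : ℕ → ℕ → Set
Tuple d k = Fin (d ^ k)

_[_] : ∀ {d k} → Tuple d k → Fin k → Fin d
_[_] {d} {k} t i = finToFun {d} {k} t i

record Relation (d : ℕ) : Set where
  field
    arity        : ℕ
    .{{arity≥1}} : NonZero arity
    tuples       : Subset (d ^ arity)

open Relation public

record Constraint (n d : ℕ) : Set where
  field
    relation : Relation d
    scope    : Vec (Fin n) (arity relation)

open Constraint public

-- The set X is Fin #variables; the set C is enumerated without repetition by
-- the injection constraint, and constraints are referred to by their index.

record Instance (d : ℕ) : Set where
  field
    #variables   : ℕ
    #constraints : ℕ
    constraint   : Fin #constraints → Constraint #variables d
    distinct     : Injective _≡_ _≡_ constraint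

  Var : Set
  Var = Fin #variables

  Con : Set
  Con = Fin #constraints

  rel : Con → Relation d
  rel c = relation (constraint c)

  ar : Con → ℕ
  ar c = arity (rel c)

  sc : (c : Con) → Vec Var (ar c)
  sc c = scope (constraint c)

ConstraintLanguage : ℕ → Set
ConstraintLanguage d = List (Relation d)

_∈CSP_ : ∀ {d} → Instance d → ConstraintLanguage d → Set
I ∈CSP Γ = ∀ c → rel c List.∈ Γ
  where open Instance I

module BLP {a ℓ₁ ℓ₂} (K : OrderedField a ℓ₁ ℓ₂) {d : ℕ} (I : Instance d) where
  open OrderedField K
  open Instance I

  ∑ : ∀ {n} → (Fin n → Carrier) → Carrier
  ∑ = sum +-rawMonoid

  -- Only the values con c t with t in the relation of c are variables of the
  -- program; IsFeasible neither constrains nor uses con at other tuples.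
  record Assignment : Set a where
    field
      var : Var → Fin d → Carrier
      con : (c : Con) → Tuple d (ar c) → Carrier

  InUnitInterval : Carrier → Set ℓ₂
  InUnitInterval x = (0# ≤ x) × (x ≤ 1#)

  record IsFeasible (v : Assignment) : Set (ℓ₁ ⊔ˡ ℓ₂) where
    open Assignment v
    field
      var-range : ∀ x e → InUnitInterval (var x e)
      con-range : ∀ c t → t ∈ˢ tuples (rel c) → InUnitInterval (con c t)
      var-sum   : ∀ x → ∑ (λ e → var x e) ≈ 1#
      marginal  : ∀ c i e →
        ∑ (λ t → if does ((t ∈ˢ? tuples (rel c)) ×-dec (t [ i ] ≟ e))
                 then con c t else 0#)
          - var (lookup (sc c) i) e ≈ 0#

  Feasible : Set (a ⊔ˡ ℓ₁ ⊔ˡ ℓ₂)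
  Feasible = ∃[ v ] IsFeasible v

-- Multisets are lists up to permutation.
Multiset : Setoid 0ℓ 0ℓ → Setoid 0ℓ 0ℓ
Multiset S = Permutation.↭-setoid S

module IteratedDegree {d : ℕ} (I : Instance d) where
  open Instance I

  Node : Set
  Node = Var ⊎ Con

  Label : Set
  Label = Σ[ R ∈ Relation d ] Subset (arity R)

  label : Var → Con → Label
  label x c = rel c , tabulate (λ i → does (lookup (sc c) i ≟ x))

  open DecVec (_≟_ {#variables}) using (_∈?_)

  -- The edges of the factor graph at a node v, as pairs of the label of the
  -- edge and the neighbour; each neighbour of v is listed exactly once.
  neighbours : Node → List (Label × Node)
  neighbours (inj₁ x) =
    map (λ c → label x c , inj₂ c) (filter (λ c → x ∈? sc c) (allFin #constraints))
  neighbours (inj₂ c) =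
    map (λ x → label x c , inj₁ x) (filter (λ x → x ∈? sc c) (allFin #variables))

  data Symbol : Set where
    variable-symbol constraint-symbol : Symbol

  Degree : ℕ → Setoid 0ℓ 0ℓ
  Degree zero    = setoid Symbol
  Degree (suc k) = Multiset (setoid Label ×ₛ Degree k)

  δ : ∀ k → Node → Setoid.Carrier (Degree k)
  δ zero    (inj₁ _) = variable-symbol
  δ zero    (inj₂ _) = constraint-symbol
  δ (suc k) v        = map (map₂ (δ k)) (neighbours v)

  infix 4 _∼δ_
  _∼δ_ : Node → Node → Set
  v ∼δ v′ = ∀ k → Setoid._≈_ (Degree k) (δ k v) (δ k v′)

{-# OPTIONS --safe #-}

-- Average a feasible solution over the classes of an equivalence relation ∼ on
-- variables, extended to constraints by: same relation and positionwise ∼.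
-- The average satisfies the marginal equations as soon as ∼ is equitable: for
-- x ∼ x′, a constraint c₀ and a position i, as many constraints of the class of
-- c₀ carry x at position i as carry x′.  Indeed, if N is this number for
-- x = s_c[i], then |[c]| = |[x]| N, so that averaging over [c] and reading off
-- position i is the same as averaging over [x].  Such a ∼ that contains ∼δ is
-- obtained by decidable colour refinement, stopped where it stabilises; the
-- k-th refinement is implied by equality of the iterated degrees of order 2k.

module Submission where

import Algebra.Properties.CommutativeSemigroup as CommutativeSemigroupProperties
import Algebra.Properties.Monoid.Mult as Mult
import Algebra.Properties.Ring as RingProperties
import Algebra.Properties.Semiring.Sum as Sum
open import Axiom.UniquenessOfIdentityProofs using (module Decidable⇒UIP)
open import Data.Bool using (true; false; if_then_else_)
import Data.Bool.Properties as Bool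
open import Data.Empty using (⊥-elim)
open import Data.Fin using (Fin; zero; suc; _≟_; remQuot)
open import Data.Fin.Properties using (all?; remQuot-combine)
open import Data.Fin.Subset using (Subset; _∈_; _⊆_; _⊂_)
open import Data.Fin.Subset.Induction using (⊂-wellFounded)
open import Data.Fin.Subset.Properties using (_∈?_; _⊂?_)
open import Data.List as List using (List; []; _∷_; map; filter; allFin; length)
import Data.List.Membership.Propositional as List
open import Data.List.Membership.Propositional.Properties using (∈-filter⁺; ∈-allFin)
open import Data.List.Properties using (map-∘; filter-accept; filter-reject)
open import Data.List.Relation.Binary.Permutation.Homogeneous
  using (Permutation; refl; prep; swap; trans)
open import Data.List.Relation.Binary.Permutation.Propositional as ↭ using (_↭_)
open import Data.List.Relation.Binary.Permutation.Propositional.Properties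
  using (filter-↭; ↭-length) renaming (map⁺ to ↭-map⁺)
open import Data.List.Relation.Binary.Pointwise as Pointwise using (Pointwise; []; _∷_)
open import Data.List.Relation.Unary.Any using (here; there)
open import Data.Nat as ℕ using (ℕ; zero; suc)
open import Data.Product using (Σ; Σ-syntax; ∃-syntax; _×_; _,_; proj₁; proj₂; uncurry)
open import Data.Product.Relation.Binary.Pointwise.NonDependent using (_×ₛ_)
open import Data.Sum using (inj₁; inj₂)
open import Data.Unit using (⊤; tt)
open import Data.Vec using (lookup; tabulate)
import Data.Vec.Membership.DecPropositional as DecVec
open import Data.Vec.Membership.Propositional.Properties using (∈-lookup)
open import Data.Vec.Properties using (≡-dec; lookup∘tabulate; []=⇒lookup; lookup⇒[]=)
open import Function using (_∘_; id)
open import Induction.WellFounded using (Acc; acc)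
open import Level using (Level; 0ℓ)
open import Relation.Binary
  using (Rel; Setoid; Decidable; DecidableEquality; IsEquivalence; IsTotalOrder)
open import Relation.Binary.PropositionalEquality as ≡
  using (_≡_; refl; cong; subst; subst₂; setoid)
import Relation.Binary.Reasoning.Setoid as ≈-Reasoning
open import Relation.Nullary using (¬_; Dec; yes; no; does)
open import Relation.Nullary.Decidable using (_×-dec_; map′; dec-true; dec-false)
open import Relation.Nullary.Negation using (contradiction)
import Relation.Unary as Unary

open import Defs

private
  variable
    a b : Level
    A B : Set a

-- Stabilisation of decreasing chains of subsets and relations.

subset-chain-stabilises : ∀ {m} (S : ℕ → Subset m) → (∀ k → S (suc k) ⊆ S k) →
                          ∃[ k ] S k ⊆ S (suc k)
subset-chain-stabilises S decreasing = descend 0 (⊂-wellFounded (S 0))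
  where
  descend : ∀ k → Acc _⊂_ (S k) → ∃[ k ] S k ⊆ S (suc k)
  descend k (acc rec) with S (suc k) ⊂? S k
  ... | yes smaller = descend (suc k) (rec smaller)
  ... | no ¬smaller = k , λ {x} x∈ → stays x x∈ (x ∈? S (suc k))
    where
    stays : ∀ x → x ∈ S k → Dec (x ∈ S (suc k)) → x ∈ S (suc k)
    stays x x∈ (yes x∈′) = x∈′
    stays x x∈ (no x∉)   = ⊥-elim (¬smaller (decreasing k , x , x∈ , x∉))

∈-tabulate-does⁺ : ∀ {m} {P : Fin m → Set a} (P? : Unary.Decidable P) {j} →
                   P j → j ∈ tabulate (does ∘ P?)
∈-tabulate-does⁺ P? {j} p =
  lookup⇒[]= j _ (≡.trans (lookup∘tabulate (does ∘ P?) j) (dec-true (P? j) p))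

does⇒ : (A? : Dec A) → does A? ≡ true → A
does⇒ (yes p) _ = p

∈-tabulate-does⁻ : ∀ {m} {P : Fin m → Set a} (P? : Unary.Decidable P) {j} →
                   j ∈ tabulate (does ∘ P?) → P j
∈-tabulate-does⁻ P? {j} j∈ =
  does⇒ (P? j) (≡.trans (≡.sym (lookup∘tabulate (does ∘ P?) j)) ([]=⇒lookup j∈))

-- Pairs are coded in `Fin (n * n)` by `remQuot`, which makes the chain of relations a chain of
-- subsets, where strict inclusion is well founded.
relation-chain-stabilises :
  ∀ {n} (R : ℕ → Rel (Fin n) 0ℓ) → (∀ k → Decidable (R k)) →
  (∀ k {x y} → R (suc k) x y → R k x y) →
  ∃[ k ] (∀ {x y} → R k x y → R (suc k) x y)
relation-chain-stabilises {n} R R? decreasing = k , stable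
  where
  P : ℕ → Fin (n ℕ.* n) → Set
  P k = uncurry (R k) ∘ remQuot {n} n

  P? : ∀ k → Unary.Decidable (P k)
  P? k j = R? k _ _

  stabilises : ∃[ k ] tabulate (does ∘ P? k) ⊆ tabulate (does ∘ P? (suc k))
  stabilises = subset-chain-stabilises (λ k → tabulate (does ∘ P? k))
    (λ k → ∈-tabulate-does⁺ (P? k) ∘ decreasing k ∘ ∈-tabulate-does⁻ (P? (suc k)))

  k : ℕ
  k = proj₁ stabilises

  stable : ∀ {x y} → R k x y → R (suc k) x y
  stable {x} {y} r = subst (uncurry (R (suc k))) (remQuot-combine x y)
    (∈-tabulate-does⁻ (P? (suc k)) (proj₂ stabilises (∈-tabulate-does⁺ (P? k)
      (subst (uncurry (R k)) (≡.sym (remQuot-combine x y)) r))))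

-- Permutations and filters of mapped lists.

module _ (S : Setoid 0ℓ 0ℓ) where
  open Setoid S using (_≈_) renaming (trans to ≈-trans)

  -- Each step of the permutation is replayed on preimages. The list `zs` is only pointwise equal to
  -- `map g ys` because the middle list of a `trans` need not be an image under `g`.
  ↭-align : ∀ {xs zs} (g : B → Setoid.Carrier S) (ys : List B) →
            Permutation _≈_ xs zs → Pointwise _≈_ zs (map g ys) →
            ∃[ ys′ ] (Pointwise _≈_ xs (map g ys′) × ys′ ↭ ys)
  ↭-align g ys (refl xs≋zs) zs≋ = ys , Pointwise.transitive ≈-trans xs≋zs zs≋ , ↭.refl
  ↭-align g (y ∷ ys) (prep x≈z p) (z≈ ∷ zs≋) =
    let ys′ , xs≋ , q = ↭-align g ys p zs≋ in
    y ∷ ys′ , ≈-trans x≈z z≈ ∷ xs≋ , ↭.prep y q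
  ↭-align g (y ∷ y′ ∷ ys) (swap eq₁ eq₂ p) (z≈ ∷ z′≈ ∷ zs≋) =
    let ys′ , xs≋ , q = ↭-align g ys p zs≋ in
    y′ ∷ y ∷ ys′ , ≈-trans eq₁ z′≈ ∷ ≈-trans eq₂ z≈ ∷ xs≋ , ↭.swap y′ y q
  ↭-align g ys (trans p₁ p₂) zs≋ =
    let ys₁ , ws≋ , q₁ = ↭-align g ys p₂ zs≋
        ys₂ , xs≋ , q₂ = ↭-align g ys₁ p₁ ws≋ in
    ys₂ , xs≋ , ↭.trans q₂ q₁

  -- Splits an equality of multisets into a pointwise matching, which compares individual elements,
  -- and a propositional permutation, which preserves counts.
  ↭-map-align : (f : A → Setoid.Carrier S) (g : B → Setoid.Carrier S)
                {xs : List A} {ys : List B} →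
                Permutation _≈_ (map f xs) (map g ys) →
                ∃[ ys′ ] (Pointwise (λ x y → f x ≈ g y) xs ys′ × ys′ ↭ ys)
  ↭-map-align f g p =
    let ys′ , xs≋ , q = ↭-align g _ p (Pointwise.refl (Setoid.refl S)) in
    ys′ , Pointwise.map⁻ f g xs≋ , q

  -- Converse of `↭-map-align`, used to reassemble a multiset equality once the matching has been
  -- weakened.
  ↭-map-from-align : (f : A → Setoid.Carrier S) (g : B → Setoid.Carrier S)
                     {xs : List A} {ys ys′ : List B} →
                     Pointwise (λ x y → f x ≈ g y) xs ys′ → ys′ ↭ ys →
                     Permutation _≈_ (map f xs) (map g ys)
  ↭-map-from-align f g xs≋ q =
    trans (refl (Pointwise.map⁺ f g xs≋)) (↭.↭⇒↭ₛ′ (Setoid.isEquivalence S) (↭-map⁺ g q))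

module _ {P Q : A → Set b} (P? : Unary.Decidable P) (Q? : Unary.Decidable Q)
         (P⊆Q : P Unary.⊆ Q) where

  -- Allows constraints with a given variable at a given position to be counted among the neighbours
  -- of that variable.
  filter-filter-⊆ : ∀ xs → filter P? (filter Q? xs) ≡ filter P? xs
  filter-filter-⊆ []       = refl
  filter-filter-⊆ (x ∷ xs) with P? x
  ... | yes p rewrite filter-accept Q? {x} {xs} (P⊆Q p) | filter-accept P? {x} {filter Q? xs} p =
    cong (x ∷_) (filter-filter-⊆ xs)
  ... | no ¬p with Q? x
  ...   | yes q rewrite filter-reject P? {x} {filter Q? xs} ¬p = filter-filter-⊆ xs
  ...   | no ¬q = filter-filter-⊆ xs

Pointwise-∈ : ∀ {R : A → B → Set b} {xs ys} → Pointwise R xs ys → ∀ {x} → x List.∈ xs →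
              ∃[ y ] (R x y)
Pointwise-∈ (r ∷ _)  (here refl) = _ , r
Pointwise-∈ (_ ∷ rs) (there x∈)  = Pointwise-∈ rs x∈

-- Decidable equality of constraint relations.

_≟ᴿ_ : ∀ {d} → DecidableEquality (Relation d)
record { arity = m ; tuples = S } ≟ᴿ record { arity = m′ ; tuples = S′ } with m ℕ.≟ m′
... | no m≢m′  = no λ { refl → m≢m′ refl }
... | yes refl with ≡-dec Bool._≟_ S S′
...   | yes refl = yes refl
...   | no S≢S′  = no λ { refl → S≢S′ refl }

-- Makes reading a scope along a proof of `rel c ≡ R` independent of that proof.
Relation-uip : ∀ {d} {R R′ : Relation d} (p q : R ≡ R′) → p ≡ q
Relation-uip = Decidable⇒UIP.≡-irrelevant _≟ᴿ_

firstPosition : ∀ {d} (R : Relation d) → Fin (arity R)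
firstPosition record { arity = zero ; arity≥1 = () }
firstPosition record { arity = suc n } = zero

-- Colour refinement and its comparison with iterated degrees.

module Refinement {d : ℕ} (I : Instance d) where
  open Instance I
  open IteratedDegree I

  -- The length of a scope depends on its constraint; indexing by the arity of a common `R` lets
  -- positions of different constraints be compared.
  varAt : ∀ {R} c → rel c ≡ R → Fin (arity R) → Var
  varAt c refl i = lookup (sc c) i

  module Lift (_≈_ : Rel Var 0ℓ) (_≈?_ : Decidable _≈_) where

    infix 4 _≋_ _≋?_
    -- Quantifying over all `R` and both proofs spares symmetry and transitivity any transport;
    -- `≋-intro` shows that a single proof is enough.
    _≋_ : Rel Con 0ℓ
    c ≋ c′ = rel c ≡ rel c′ ×
      (∀ {R} (p : rel c ≡ R) (p′ : rel c′ ≡ R) i → varAt c p i ≈ varAt c′ p′ i)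

    ≋-intro : ∀ {c c′} (p : rel c ≡ rel c′) → (∀ i → varAt c p i ≈ varAt c′ refl i) → c ≋ c′
    ≋-intro {c} {c′} p h = p , positions
      where
      positions : ∀ {R} (q : rel c ≡ R) (q′ : rel c′ ≡ R) i → varAt c q i ≈ varAt c′ q′ i
      positions q refl i rewrite Relation-uip q p = h i

    _≋?_ : Decidable _≋_
    c ≋? c′ with rel c ≟ᴿ rel c′
    ... | no r≢r′ = no (r≢r′ ∘ proj₁)
    ... | yes p   = map′ (≋-intro p) (λ (_ , h) → h p refl) (all? λ i → _ ≈? _)

    Hits : ∀ c₀ → Fin (ar c₀) → Var → Con → Set
    Hits c₀ i x c = c ≋ c₀ × Σ[ p ∈ rel c ≡ rel c₀ ] varAt c p i ≡ x

    hits? : ∀ c₀ i x → Unary.Decidable (Hits c₀ i x)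
    hits? c₀ i x c with c ≋? c₀
    ... | no c≋̸c₀ = no (c≋̸c₀ ∘ proj₁)
    ... | yes c≋c₀@(p , _) = map′ (λ eq → c≋c₀ , p , eq)
      (λ (_ , q , eq) → subst (λ p → varAt c p i ≡ x) (Relation-uip q p) eq) (varAt c p i ≟ x)

    #hits : ∀ c₀ → Fin (ar c₀) → Var → ℕ
    #hits c₀ i x = length (filter (hits? c₀ i x) (allFin #constraints))

    infix 4 _≈#_ _≈#?_
    -- The splitting criterion of one refinement round. Classes of constraints are named by
    -- representatives `c₀`, so the criterion is a finite conjunction and decidable.
    _≈#_ : Rel Var 0ℓ
    x ≈# x′ = ∀ c₀ i → #hits c₀ i x ≡ #hits c₀ i x′

    _≈#?_ : Decidable _≈#_
    x ≈#? x′ = all? λ c₀ → all? λ i → #hits c₀ i x ℕ.≟ #hits c₀ i x′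

    module _ (≈-equiv : IsEquivalence _≈_) where
      open IsEquivalence ≈-equiv renaming (refl to ≈-refl; sym to ≈-sym; trans to ≈-trans)

      ≋-refl : ∀ {c} → c ≋ c
      ≋-refl = ≋-intro refl λ _ → ≈-refl

      ≋-sym : ∀ {c c′} → c ≋ c′ → c′ ≋ c
      ≋-sym (p , h) = ≡.sym p , λ q q′ i → ≈-sym (h q′ q i)

      ≋-trans : ∀ {c c′ c″} → c ≋ c′ → c′ ≋ c″ → c ≋ c″
      ≋-trans (p , h) (p′ , h′) = ≡.trans p p′ , λ q q″ i →
        ≈-trans (h q (≡.trans (≡.sym p) q) i) (h′ (≡.trans (≡.sym p) q) q″ i)

  -- Keeping x ≈ x′ in the step makes the chain decreasing by construction.
  refinement : ℕ → Σ (Rel Var 0ℓ) Decidable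
  refinement zero    = (λ _ _ → ⊤) , λ _ _ → yes tt
  refinement (suc k) =
    let _≈_ , _≈?_ = refinement k
        open Lift _≈_ _≈?_ in
    (λ x x′ → x ≈ x′ × x ≈# x′) , λ x x′ → (x ≈? x′) ×-dec (x ≈#? x′)

  infix 4 _≈[_]_
  _≈[_]_ : Var → ℕ → Var → Set
  x ≈[ k ] x′ = proj₁ (refinement k) x x′

  module Stage k = Lift (proj₁ (refinement k)) (proj₂ (refinement k))

  ≈-isEquivalence : ∀ k → IsEquivalence (_≈[ k ]_)
  ≈-isEquivalence zero    = _
  ≈-isEquivalence (suc k) = record
    { refl  = R.refl , λ _ _ → refl
    ; sym   = λ (r , h) → R.sym r , λ c i → ≡.sym (h c i)
    ; trans = λ (r , h) (r′ , h′) → R.trans r r′ , λ c i → ≡.trans (h c i) (h′ c i)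
    }
    where module R = IsEquivalence (≈-isEquivalence k)

  infix 4 _≈δ[_]_
  _≈δ[_]_ : Node → ℕ → Node → Set
  v ≈δ[ k ] v′ = Setoid._≈_ (Degree k) (δ k v) (δ k v′)

  open DecVec (_≟_ {#variables}) using () renaming (_∈_ to _∈ⱽ_; _∈?_ to _∈ⱽ?_)

  constraintsOf : Var → List Con
  constraintsOf x = filter (λ c → x ∈ⱽ? sc c) (allFin #constraints)

  variablesOf : Con → List Var
  variablesOf c = filter (λ x → x ∈ⱽ? sc c) (allFin #variables)

  -- A matching of the incident constraints that preserves edge labels and lowers the order by one;
  -- `map-∘` fuses the two maps in the definition of `δ`.
  align-var : ∀ k {x x′} → inj₁ x ≈δ[ suc k ] inj₁ x′ →
    ∃[ cs ] (Pointwise (λ c c′ → label x c ≡ label x′ c′ × inj₂ c ≈δ[ k ] inj₂ c′)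
                       (constraintsOf x) cs
             × cs ↭ constraintsOf x′)
  align-var k {x} {x′} eq = ↭-map-align (setoid Label ×ₛ Degree k) _ _
    (subst₂ (Setoid._≈_ (Degree (suc k)))
      (≡.sym (map-∘ (constraintsOf x))) (≡.sym (map-∘ (constraintsOf x′))) eq)

  align-con : ∀ k {c c′} → inj₂ c ≈δ[ suc k ] inj₂ c′ →
    ∃[ xs ] (Pointwise (λ x x′ → label x c ≡ label x′ c′ × inj₁ x ≈δ[ k ] inj₁ x′)
                       (variablesOf c) xs
             × xs ↭ variablesOf c′)
  align-con k {c} {c′} eq = ↭-map-align (setoid Label ×ₛ Degree k) _ _
    (subst₂ (Setoid._≈_ (Degree (suc k)))
      (≡.sym (map-∘ (variablesOf c))) (≡.sym (map-∘ (variablesOf c′))) eq)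

  -- Match the neighbours, weaken their degrees by mutual induction, and reassemble. At order zero
  -- all nodes of one kind share a symbol.
  δ-mono-var : ∀ k {x x′} → inj₁ x ≈δ[ suc k ] inj₁ x′ → inj₁ x ≈δ[ k ] inj₁ x′
  δ-mono-con : ∀ k {c c′} → inj₂ c ≈δ[ suc k ] inj₂ c′ → inj₂ c ≈δ[ k ] inj₂ c′
  δ-mono-var zero    _  = refl
  δ-mono-var (suc k) {x} {x′} eq =
    let cs , pw , q = align-var (suc k) eq in
    subst₂ (Setoid._≈_ (Degree (suc k))) (map-∘ (constraintsOf x)) (map-∘ (constraintsOf x′))
      (↭-map-from-align (setoid Label ×ₛ Degree k) _ _
        (Pointwise.map (λ (l , e) → l , δ-mono-con k e) pw) q)
  δ-mono-con zero    _  = refl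
  δ-mono-con (suc k) {c} {c′} eq =
    let xs , pw , q = align-con (suc k) eq in
    subst₂ (Setoid._≈_ (Degree (suc k))) (map-∘ (variablesOf c)) (map-∘ (variablesOf c′))
      (↭-map-from-align (setoid Label ×ₛ Degree k) _ _
        (Pointwise.map (λ (l , e) → l , δ-mono-var k e) pw) q)

  label-varAt : ∀ {R S x c} → (R , S) ≡ label x c → ∀ {i} → lookup S i ≡ true →
                Σ[ p ∈ rel c ≡ R ] varAt c p i ≡ x
  label-varAt {x = x} {c} refl {i} eq =
    refl , does⇒ (_ ≟ x) (≡.trans (≡.sym (lookup∘tabulate _ i)) eq)

  lookup-label : ∀ {R x c} (p : rel c ≡ R) {S i} → (R , S) ≡ label x c → varAt c p i ≡ x →
                 lookup S i ≡ true
  lookup-label {x = x} p {i = i} refl eq rewrite Relation-uip p refl =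
    ≡.trans (lookup∘tabulate _ i) (dec-true (_ ≟ x) eq)

  -- A label stores the relation and every position of the variable in the scope.
  label-positions : ∀ {x x′ c c′ R} → label x c ≡ label x′ c′ →
                    (p : rel c ≡ R) → ∀ {i} → varAt c p i ≡ x →
                    Σ[ p′ ∈ rel c′ ≡ R ] varAt c′ p′ i ≡ x′
  label-positions eq refl at = label-varAt eq (lookup-label refl refl at)

  -- The variable at position `i` of `c` is a neighbour of `c`. Its match has the same label, hence
  -- sits at position `i` of `c′`.
  δ-con⇒positions : ∀ k {c c′} → inj₂ c ≈δ[ suc k ] inj₂ c′ → ∀ i →
    Σ[ p ∈ rel c′ ≡ rel c ] inj₁ (varAt c refl i) ≈δ[ k ] inj₁ (varAt c′ p i)
  δ-con⇒positions k {c} {c′} eq i =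
    let _ , pw , _ = align-con k eq
        x′ , l , e = Pointwise-∈ pw (∈-filter⁺ (λ x → x ∈ⱽ? sc c) (∈-allFin _) (∈-lookup i (sc c)))
        p , at     = label-positions l refl refl in
    p , subst (λ y → _ ≈δ[ k ] inj₁ y) (≡.sym at) e

  -- Each position brings its own proof that the relations agree. The one from the first position,
  -- which exists since arities are positive, is fixed, and the others are identified with it.
  δ⇒≋ : ∀ k m → (∀ {x x′} → inj₁ x ≈δ[ k ] inj₁ x′ → x ≈[ m ] x′) →
        ∀ {c c′} → inj₂ c ≈δ[ suc k ] inj₂ c′ → Stage._≋_ m c c′
  δ⇒≋ k m δ⇒≈ {c} {c′} eq = ≋-sym (≈-isEquivalence m) (≋-intro p λ i → ≈.sym (same i))
    where
    open Stage m
    module ≈ = IsEquivalence (≈-isEquivalence m)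
    p : rel c′ ≡ rel c
    p = proj₁ (δ-con⇒positions k eq (firstPosition (rel c)))
    same : ∀ i → varAt c refl i ≈[ m ] varAt c′ p i
    same i with q , e ← δ-con⇒positions k eq i rewrite Relation-uip p q = δ⇒≈ e

  module _ (m : ℕ) where
    open Stage m
    private ≈-equiv = ≈-isEquivalence m

    -- The matching of the constraints around `x` with those around `x′` preserves classes, by
    -- `δ⇒≋`, and positions, by equality of labels. It therefore matches the hits of `x` with those
    -- of `x′`.
    δ⇒≈# : ∀ k → (∀ {c c′} → inj₂ c ≈δ[ k ] inj₂ c′ → c ≋ c′) →
           ∀ {x x′} → inj₁ x ≈δ[ suc k ] inj₁ x′ → x ≈# x′
    δ⇒≈# k δ⇒≋ {x} {x′} eq c₀ i with cs , pw , q ← align-var k eq = begin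
      #hits c₀ i x
        ≡⟨ cong length (filter-filter-⊆ (hits? c₀ i x) (λ c → x ∈ⱽ? sc c) occurs (allFin _)) ⟨
      length (filter (hits? c₀ i x) (constraintsOf x))
        ≡⟨ Pointwise.Pointwise-length
             (Pointwise.filter⁺ (hits? c₀ i x) (hits? c₀ i x′) to from pw) ⟩
      length (filter (hits? c₀ i x′) cs)
        ≡⟨ ↭-length (filter-↭ (hits? c₀ i x′) q) ⟩
      length (filter (hits? c₀ i x′) (constraintsOf x′))
        ≡⟨ cong length (filter-filter-⊆ (hits? c₀ i x′) (λ c → x′ ∈ⱽ? sc c) occurs (allFin _)) ⟩
      #hits c₀ i x′ ∎
      where
      open ≡.≡-Reasoning
      varAt-∈ : ∀ {R} c (p : rel c ≡ R) i → varAt c p i ∈ⱽ sc c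
      varAt-∈ c refl i = ∈-lookup i (sc c)
      occurs : ∀ {x c} → Hits c₀ i x c → x ∈ⱽ sc c
      occurs (_ , p , refl) = varAt-∈ _ p i
      to : ∀ {c c′} → label x c ≡ label x′ c′ × inj₂ c ≈δ[ k ] inj₂ c′ →
           Hits c₀ i x c → Hits c₀ i x′ c′
      to (l , e) (c≋c₀ , p , at) =
        ≋-trans ≈-equiv (≋-sym ≈-equiv (δ⇒≋ e)) c≋c₀ , label-positions l p at
      from : ∀ {c c′} → label x c ≡ label x′ c′ × inj₂ c ≈δ[ k ] inj₂ c′ →
             Hits c₀ i x′ c′ → Hits c₀ i x c
      from (l , e) (c′≋c₀ , p , at) =
        ≋-trans ≈-equiv (δ⇒≋ e) c′≋c₀ , label-positions (≡.sym l) p at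

  -- A refinement round passes from variables to constraints and back, which costs two orders of
  -- iterated degree.
  δ⇒≈ : ∀ m {x x′} → inj₁ x ≈δ[ m ℕ.* 2 ] inj₁ x′ → x ≈[ m ] x′
  δ⇒≈ zero    _  = tt
  δ⇒≈ (suc m) eq =
    δ⇒≈ m (δ-mono-var (m ℕ.* 2) (δ-mono-var (suc (m ℕ.* 2)) eq)) ,
    δ⇒≈# m (suc (m ℕ.* 2)) (δ⇒≋ (m ℕ.* 2) m (δ⇒≈ m)) eq

  -- At such a stage the relation implies its own splitting criterion, that is, it is equitable.
  stable-stage : ∃[ k ] (∀ {x x′} → x ≈[ k ] x′ → x ≈[ suc k ] x′)
  stable-stage = 
    relation-chain-stabilises (proj₁ ∘ refinement) (proj₂ ∘ refinement) (λ _ → proj₁)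

-- Indicator sums and averages over an ordered field.

module Averaging {a ℓ₁ ℓ₂} (K : OrderedField a ℓ₁ ℓ₂) where
  open OrderedField K hiding (zero)
    renaming (refl to ≈-refl; sym to ≈-sym; trans to ≈-trans; setoid to ≈-setoid)
  open Sum semiring using (sum; sum-cong-≋; ∑-comm; *-distribˡ-sum; *-distribʳ-sum)
  open RingProperties ring using (-‿distribʳ-*; -‿distribˡ-*; -‿involutive)
  open CommutativeSemigroupProperties *-commutativeSemigroup using (x∙yz≈y∙xz)
  open Mult +-monoid using () renaming (_×_ to _·_)
  open IsTotalOrder isTotalOrder using (total; antisym)
    renaming (trans to ≤-trans; refl to ≤-refl; reflexive to ≤-reflexive)

  ≤-resp : ∀ {x x′ y y′} → x ≈ x′ → y ≈ y′ → x ≤ y → x′ ≤ y′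
  ≤-resp x≈x′ y≈y′ x≤y = ≤-trans (≤-reflexive (≈-sym x≈x′)) (≤-trans x≤y (≤-reflexive y≈y′))

  +-mono-≤ : ∀ {x x′ y y′} → x ≤ x′ → y ≤ y′ → x + y ≤ x′ + y′
  +-mono-≤ x≤x′ y≤y′ =
    ≤-trans (+-monoˡ-≤ _ x≤x′) (≤-resp (+-comm _ _) (+-comm _ _) (+-monoˡ-≤ _ y≤y′))

  x≤y⇒0≤y-x : ∀ {x y} → x ≤ y → 0# ≤ y - x
  x≤y⇒0≤y-x {x} x≤y = ≤-resp (-‿inverseʳ x) ≈-refl (+-monoˡ-≤ (- x) x≤y)

  0≤y-x⇒x≤y : ∀ {x y} → 0# ≤ y - x → x ≤ y
  0≤y-x⇒x≤y {x} {y} 0≤ = ≤-resp (+-identityˡ x)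
    (≈-trans (+-assoc y (- x) x) (≈-trans (+-congˡ (-‿inverseˡ x)) (+-identityʳ y)))
    (+-monoˡ-≤ x 0≤)

  x-y≈0⇒x≈y : ∀ {x y} → x - y ≈ 0# → x ≈ y
  x-y≈0⇒x≈y {x} {y} eq = begin
    x            ≈⟨ +-identityʳ x ⟨
    x + 0#       ≈⟨ +-congˡ (-‿inverseˡ y) ⟨
    x + (- y + y) ≈⟨ +-assoc x (- y) y ⟨
    x - y + y    ≈⟨ +-congʳ eq ⟩
    0# + y       ≈⟨ +-identityˡ y ⟩
    y            ∎
    where open ≈-Reasoning ≈-setoid

  x≤0⇒0≤-x : ∀ {x} → x ≤ 0# → 0# ≤ - x
  x≤0⇒0≤-x x≤0 = ≤-resp ≈-refl (+-identityˡ _) (x≤y⇒0≤y-x x≤0)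

  -- If `1# ≤ 0#`, then `1#` is the square of the nonnegative element `- 1#`.
  0≤1 : 0# ≤ 1#
  0≤1 with total 0# 1#
  ... | inj₁ 0≤1 = 0≤1
  ... | inj₂ 1≤0 = ≤-resp ≈-refl
    (≈-trans (≈-sym (-‿distribˡ-* 1# (- 1#))) (≈-trans (-‿cong (*-identityˡ _)) (-‿involutive 1#)))
    (*-nonneg (x≤0⇒0≤-x 1≤0) (x≤0⇒0≤-x 1≤0))

  1≰0 : ¬ (1# ≤ 0#)
  1≰0 1≤0 = 0≉1 (antisym 0≤1 1≤0)

  *-monoʳ-≤ : ∀ {x y z} → 0# ≤ z → x ≤ y → z * x ≤ z * y
  *-monoʳ-≤ {x} {y} {z} 0≤z x≤y = 0≤y-x⇒x≤y (≤-resp ≈-refl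
    (≈-trans (distribˡ z y (- x)) (+-congˡ (≈-sym (-‿distribʳ-* z x))))
    (*-nonneg 0≤z (x≤y⇒0≤y-x x≤y)))

  -- Multiplying `y ≤ 0#` by `x` would give `1# ≤ 0#`.
  inverse-nonneg : ∀ {x y} → 0# ≤ x → x * y ≈ 1# → 0# ≤ y
  inverse-nonneg {x} {y} 0≤x xy≈1 with total 0# y
  ... | inj₁ 0≤y = 0≤y
  ... | inj₂ y≤0 = contradiction (≤-resp xy≈1 (zeroʳ x) (*-monoʳ-≤ 0≤x y≤0)) 1≰0

  sum-mono-≤ : ∀ {n} {f g : Fin n → Carrier} → (∀ j → f j ≤ g j) → sum f ≤ sum g
  sum-mono-≤ {zero}  f≤g = ≤-refl
  sum-mono-≤ {suc n} f≤g = +-mono-≤ (f≤g zero) (sum-mono-≤ (f≤g ∘ suc))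

  sum-zero : ∀ {n} {f : Fin n → Carrier} → (∀ j → f j ≈ 0#) → sum f ≈ 0#
  sum-zero {zero}  f≈0 = ≈-refl
  sum-zero {suc n} f≈0 = ≈-trans (+-cong (f≈0 zero) (sum-zero (f≈0 ∘ suc))) (+-identityˡ 0#)

  sum-nonneg : ∀ {n} {f : Fin n → Carrier} → (∀ j → 0# ≤ f j) → 0# ≤ sum f
  sum-nonneg {n} 0≤f = ≤-resp (sum-zero {n} (λ _ → ≈-refl)) ≈-refl (sum-mono-≤ 0≤f)

  term≤sum : ∀ {n} {f : Fin n → Carrier} → (∀ j → 0# ≤ f j) → ∀ j → f j ≤ sum f
  term≤sum 0≤f zero    = ≤-resp (+-identityʳ _) ≈-refl (+-mono-≤ ≤-refl (sum-nonneg (0≤f ∘ suc)))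
  term≤sum 0≤f (suc j) = ≤-resp (+-identityˡ _) ≈-refl (+-mono-≤ (0≤f zero) (term≤sum (0≤f ∘ suc) j))

  -- Indicators as factors turn a sum over a class into a sum over the whole index set, open to
  -- distributivity and interchange.
  𝟙 : Dec A → Carrier
  𝟙 A? = if does A? then 1# else 0#

  𝟙-yes : (A? : Dec A) → A → 𝟙 A? ≈ 1#
  𝟙-yes A? p rewrite dec-true A? p = ≈-refl

  𝟙-no : (A? : Dec A) → ¬ A → 𝟙 A? ≈ 0#
  𝟙-no A? ¬p rewrite dec-false A? ¬p = ≈-refl

  𝟙-cong : (A? : Dec A) (B? : Dec B) → (A → B) → (B → A) → 𝟙 A? ≈ 𝟙 B?
  𝟙-cong (yes p) B? f g = ≈-sym (𝟙-yes B? (f p))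
  𝟙-cong (no ¬p) B? f g = ≈-sym (𝟙-no B? (¬p ∘ g))

  0≤𝟙 : (A? : Dec A) → 0# ≤ 𝟙 A?
  0≤𝟙 (yes _) = 0≤1
  0≤𝟙 (no _)  = ≤-refl

  if≈𝟙* : (A? : Dec A) (x : Carrier) → (if does A? then x else 0#) ≈ 𝟙 A? * x
  if≈𝟙* (yes _) x = ≈-sym (*-identityˡ x)
  if≈𝟙* (no _)  x = ≈-sym (zeroˡ x)

  𝟙*-cong : (A? : Dec A) {x y : Carrier} → (A → x ≈ y) → 𝟙 A? * x ≈ 𝟙 A? * y
  𝟙*-cong (yes p) x≈y = *-congˡ (x≈y p)
  𝟙*-cong (no _)  x≈y = ≈-trans (zeroˡ _) (≈-sym (zeroˡ _))

  𝟙*-range : (A? : Dec A) {x : Carrier} → (A → (0# ≤ x) × (x ≤ 1#)) →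
             (0# ≤ 𝟙 A? * x) × (𝟙 A? * x ≤ 𝟙 A?)
  𝟙*-range (yes p) h = let 0≤x , x≤1 = h p in
    ≤-resp ≈-refl (≈-sym (*-identityˡ _)) 0≤x , ≤-resp (≈-sym (*-identityˡ _)) ≈-refl x≤1
  𝟙*-range (no _)  h = ≤-reflexive (≈-sym (zeroˡ _)) , ≤-reflexive (zeroˡ _)

  sum-𝟙-≟ : ∀ {n} (i : Fin n) (f : Fin n → Carrier) → sum (λ j → 𝟙 (i ≟ j) * f j) ≈ f i
  sum-𝟙-≟ {suc n} zero    f =
    ≈-trans (+-cong (*-identityˡ _) (sum-zero {n} λ j → zeroˡ _)) (+-identityʳ _)
  sum-𝟙-≟ {suc n} (suc i) f =
    ≈-trans (+-cong (zeroˡ _) (sum-𝟙-≟ i (f ∘ suc))) (+-identityˡ _)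

  module _ {n} {P : Fin n → Set} (P? : Unary.Decidable P) where

    size : Carrier
    size = sum (𝟙 ∘ P?)

    sumOver : (Fin n → Carrier) → Carrier
    sumOver f = sum (λ j → 𝟙 (P? j) * f j)

    size≥1 : ∀ {j} → P j → 1# ≤ size
    size≥1 {j} p = ≤-resp (𝟙-yes (P? j) p) ≈-refl (term≤sum (0≤𝟙 ∘ P?) j)

  -- Carries equal counts in ℕ over to equal sizes in the field. The function `f` generalises `id`,
  -- as the induction on `n` requires.
  size≈length : ∀ {n m} {P : Fin m → Set} (P? : Unary.Decidable P) (f : Fin n → Fin m) →
                size (P? ∘ f) ≈ length (filter P? (List.tabulate f)) · 1#
  size≈length {zero}  P? f = ≈-refl
  size≈length {suc n} P? f with does (P? (f zero))
  ... | true  = +-congˡ (size≈length P? (f ∘ suc))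
  ... | false = ≈-trans (+-identityˡ _) (size≈length P? (f ∘ suc))

  size-cong : ∀ {n} {P Q : Fin n → Set} (P? : Unary.Decidable P) (Q? : Unary.Decidable Q) →
              length (filter P? (allFin n)) ≡ length (filter Q? (allFin n)) → size P? ≈ size Q?
  size-cong P? Q? eq = ≈-trans (size≈length P? id)
    (≈-trans (reflexive (cong (_· 1#) eq)) (≈-sym (size≈length Q? id)))

  module Average {n} {P : Fin n → Set} (P? : Unary.Decidable P) (inhabited : Σ (Fin n) P) where

    private
      size⁻¹ : ∃[ y ] (size P? * y ≈ 1#)
      -- An inhabited class has size at least `1#`, so its size is not zero.
      size⁻¹ = inverse (size P?) λ s≈0 → 1≰0 (≤-resp ≈-refl s≈0 (size≥1 P? (proj₂ inhabited)))

    weight : Carrier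
    weight = proj₁ size⁻¹

    size*weight : size P? * weight ≈ 1#
    size*weight = proj₂ size⁻¹

    0≤weight : 0# ≤ weight
    0≤weight = inverse-nonneg (sum-nonneg (0≤𝟙 ∘ P?)) size*weight

    average : (Fin n → Carrier) → Carrier
    average f = weight * sumOver P? f

    weight*size : weight * size P? ≈ 1#
    weight*size = ≈-trans (*-comm _ _) size*weight

    average-range : ∀ {f} → (∀ j → P j → (0# ≤ f j) × (f j ≤ 1#)) →
                    (0# ≤ average f) × (average f ≤ 1#)
    average-range h =
      *-nonneg 0≤weight (sum-nonneg λ j → proj₁ (𝟙*-range (P? j) (h j))) ,
      ≤-resp ≈-refl weight*size (*-monoʳ-≤ 0≤weight (sum-mono-≤ λ j → proj₂ (𝟙*-range (P? j) (h j))))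

    average-const : ∀ {f x} → (∀ j → P j → f j ≈ x) → average f ≈ x
    average-const {f} {x} h = begin
      weight * sumOver P? f          ≈⟨ *-congˡ (sum-cong-≋ λ j → 𝟙*-cong (P? j) (h j)) ⟩
      weight * sumOver P? (λ _ → x)  ≈⟨ *-congˡ (*-distribʳ-sum x (𝟙 ∘ P?)) ⟨
      weight * (size P? * x)         ≈⟨ *-assoc _ _ _ ⟨
      weight * size P? * x           ≈⟨ *-congʳ weight*size ⟩
      1# * x                         ≈⟨ *-identityˡ x ⟩
      x                              ∎
      where open ≈-Reasoning ≈-setoid

    -- An average is a linear combination with fixed coefficients, so finite weighted sums pass
    -- through it.
    average-comm : ∀ {m} (w : Fin m → Carrier) (f : Fin m → Fin n → Carrier) →
                   sum (λ t → w t * average (f t)) ≈ average (λ j → sum (λ t → w t * f t j))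
    average-comm {m} w f = begin
      sum (λ t → w t * (weight * sum (λ j → 𝟙 (P? j) * f t j)))
        ≈⟨ sum-cong-≋ {m} (λ t → x∙yz≈y∙xz _ _ _) ⟩
      sum (λ t → weight * (w t * sum (λ j → 𝟙 (P? j) * f t j)))
        ≈⟨ *-distribˡ-sum {m} weight _ ⟨
      weight * sum (λ t → w t * sum (λ j → 𝟙 (P? j) * f t j))
        ≈⟨ *-congˡ (sum-cong-≋ {m} λ t → *-distribˡ-sum {n} (w t) _) ⟩
      weight * sum (λ t → sum (λ j → w t * (𝟙 (P? j) * f t j)))
        ≈⟨ *-congˡ (∑-comm {m} {n} _) ⟩
      weight * sum (λ j → sum (λ t → w t * (𝟙 (P? j) * f t j)))
        ≈⟨ *-congˡ (sum-cong-≋ {n} λ j → sum-cong-≋ {m} λ t → x∙yz≈y∙xz _ _ _) ⟩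
      weight * sum (λ j → sum (λ t → 𝟙 (P? j) * (w t * f t j)))
        ≈⟨ *-congˡ (sum-cong-≋ {n} λ j → *-distribˡ-sum {m} (𝟙 (P? j)) _) ⟨
      weight * sum (λ j → 𝟙 (P? j) * sum (λ t → w t * f t j)) ∎
      where open ≈-Reasoning ≈-setoid

  -- Identifies weights obtained from separate calls of `inverse`, which is not assumed to respect
  -- `≈`.
  inverse-unique : ∀ {x x′ y y′} → x ≈ x′ → y * x ≈ 1# → x′ * y′ ≈ 1# → y ≈ y′
  inverse-unique {x} {x′} {y} {y′} x≈x′ yx≈1 x′y′≈1 = begin
    y              ≈⟨ *-identityʳ y ⟨
    y * 1#         ≈⟨ *-congˡ x′y′≈1 ⟨
    y * (x′ * y′)  ≈⟨ *-assoc y x′ y′ ⟨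
    y * x′ * y′    ≈⟨ *-congʳ (*-congˡ x≈x′) ⟨
    y * x * y′     ≈⟨ *-congʳ yx≈1 ⟩
    1# * y′        ≈⟨ *-identityˡ y′ ⟩
    y′             ∎
    where open ≈-Reasoning ≈-setoid

  average-⇔ : ∀ {n} {P Q : Fin n → Set} (P? : Unary.Decidable P) (Q? : Unary.Decidable Q) p q →
              P Unary.⊆ Q → Q Unary.⊆ P → ∀ f → Average.average P? p f ≈ Average.average Q? q f
  average-⇔ P? Q? p q P⊆Q Q⊆P f = *-cong
    (inverse-unique (sum-cong-≋ 𝟙P≈𝟙Q) (Average.weight*size P? p) (Average.size*weight Q? q))
    (sum-cong-≋ λ j → *-congʳ (𝟙P≈𝟙Q j))
    where
    𝟙P≈𝟙Q : ∀ j → 𝟙 (P? j) ≈ 𝟙 (Q? j)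
    𝟙P≈𝟙Q j = 𝟙-cong (P? j) (Q? j) P⊆Q Q⊆P

-- Averaging a feasible solution over an equitable equivalence relation.

module Symmetrisation {a ℓ₁ ℓ₂} (K : OrderedField a ℓ₁ ℓ₂) {d : ℕ} (I : Instance d)
  (_∼_ : Rel (Instance.Var I) 0ℓ) (_∼?_ : Decidable _∼_) (∼-equiv : IsEquivalence _∼_)
  (∼⇒∼# : ∀ {x x′} → x ∼ x′ → Refinement.Lift._≈#_ I _∼_ _∼?_ x x′)
  where

  open OrderedField K hiding (zero)
    renaming (refl to ≈-refl; sym to ≈-sym; trans to ≈-trans; setoid to ≈-setoid)
  open Sum semiring using (sum; sum-cong-≋; ∑-comm; *-distribˡ-sum; *-distribʳ-sum)
  open Averaging K
  open Instance I
  open Refinement I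
  open Lift _∼_ _∼?_ hiding (_≈#_; _≈#?_)
  open BLP K I
  module ∼ = IsEquivalence ∼-equiv

  -- A constraint in the class of `c` carries exactly one variable at position `i`, so one term of
  -- the sum survives; outside the class all terms vanish.
  hits-fibre : ∀ c i c′ (g : Var → Carrier) {x} →
               (∀ (p : rel c′ ≡ rel c) → x ≈ g (varAt c′ p i)) →
               𝟙 (c′ ≋? c) * x ≈ sum (λ y → 𝟙 (hits? c i y c′) * g y)
  hits-fibre c i c′ g {x} h = by (c′ ≋? c)
    where
    open ≈-Reasoning ≈-setoid
    by : Dec (c′ ≋ c) → 𝟙 (c′ ≋? c) * x ≈ sum (λ y → 𝟙 (hits? c i y c′) * g y)
    by (no c′≋̸c) = begin
      𝟙 (c′ ≋? c) * x
        ≈⟨ *-congʳ (𝟙-no (c′ ≋? c) c′≋̸c) ⟩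
      0# * x
        ≈⟨ zeroˡ x ⟩
      0#
        ≈⟨ sum-zero (λ y →
             ≈-trans (*-congʳ (𝟙-no (hits? c i y c′) (c′≋̸c ∘ proj₁))) (zeroˡ _)) ⟨
      sum (λ y → 𝟙 (hits? c i y c′) * g y) ∎
    by (yes c′≋c@(p , _)) = begin
      𝟙 (c′ ≋? c) * x
        ≈⟨ *-congʳ (𝟙-yes (c′ ≋? c) c′≋c) ⟩
      1# * x
        ≈⟨ *-identityˡ x ⟩
      x
        ≈⟨ h p ⟩
      g (varAt c′ p i)
        ≈⟨ sum-𝟙-≟ (varAt c′ p i) g ⟨
      sum (λ y → 𝟙 (varAt c′ p i ≟ y) * g y)
        ≈⟨ sum-cong-≋ (λ y → *-congʳ (𝟙-cong (varAt c′ p i ≟ y) (hits? c i y c′)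
             (λ eq → c′≋c , p , eq)
             (λ (_ , q , eq) → subst (λ p → varAt c′ p i ≡ y) (Relation-uip q p) eq))) ⟩
      sum (λ y → 𝟙 (hits? c i y c′) * g y) ∎

  -- For `y` in the class of the variable at position `i` this is equitability. Any other `y` has no
  -- hits, since equivalent constraints agree positionwise up to `∼`.
  size-hits : ∀ c i y →
    size (hits? c i y) ≈ 𝟙 (y ∼? lookup (sc c) i) * size (hits? c i (lookup (sc c) i))
  size-hits c i y = by (y ∼? x)
    where
    x = lookup (sc c) i
    by : Dec (y ∼ x) → size (hits? c i y) ≈ 𝟙 (y ∼? x) * size (hits? c i x)
    by (yes y∼x) = ≈-trans (size-cong (hits? c i y) (hits? c i x) (∼⇒∼# y∼x c i))
      (≈-sym (≈-trans (*-congʳ (𝟙-yes (y ∼? x) y∼x)) (*-identityˡ _)))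
    by (no y≁x)  = ≈-trans
      (sum-zero λ c′ → 𝟙-no (hits? c i y c′) λ { ((_ , h) , p , refl) → y≁x (h p refl i) })
      (≈-sym (≈-trans (*-congʳ (𝟙-no (y ∼? x) y≁x)) (zeroˡ _)))

  -- Double counting: after the interchange, each `g y` is multiplied by the number of hits of `y`,
  -- which `size-hits` evaluates.
  sum-hits : ∀ c i (g : Var → Carrier) →
    sum (λ c′ → sum (λ y → 𝟙 (hits? c i y c′) * g y)) ≈
    size (hits? c i (lookup (sc c) i)) * sumOver (_∼? lookup (sc c) i) g
  sum-hits c i g = begin
    sum (λ c′ → sum (λ y → 𝟙 (hits? c i y c′) * g y))
      ≈⟨ ∑-comm {#constraints} {#variables} _ ⟩
    sum (λ y → sum (λ c′ → 𝟙 (hits? c i y c′) * g y))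
      ≈⟨ sum-cong-≋ (λ y → *-distribʳ-sum (g y) (𝟙 ∘ hits? c i y)) ⟨
    sum (λ y → size (hits? c i y) * g y)
      ≈⟨ sum-cong-≋ (λ y → *-congʳ (≈-trans (size-hits c i y) (*-comm _ _))) ⟩
    sum (λ y → N * 𝟙 (y ∼? x) * g y)
      ≈⟨ sum-cong-≋ {#variables} (λ y → *-assoc N _ _) ⟩
    sum (λ y → N * (𝟙 (y ∼? x) * g y))
      ≈⟨ *-distribˡ-sum {#variables} N _ ⟨
    N * sumOver (_∼? x) g ∎
    where
    open ≈-Reasoning ≈-setoid
    x = lookup (sc c) i
    N = size (hits? c i x)

  -- The double count of `sum-hits` for the constant function `1#`.
  size-≋ : ∀ c i → size (_≋? c) ≈ size (hits? c i (lookup (sc c) i)) * size (_∼? lookup (sc c) i)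
  size-≋ c i = begin
    size (_≋? c)
      ≈⟨ sum-cong-≋ (λ c′ → *-identityʳ (𝟙 (c′ ≋? c))) ⟨
    sum (λ c′ → 𝟙 (c′ ≋? c) * 1#)
      ≈⟨ sum-cong-≋ (λ c′ → hits-fibre c i c′ (λ _ → 1#) (λ _ → ≈-refl)) ⟩
    sum (λ c′ → sum (λ y → 𝟙 (hits? c i y c′) * 1#))
      ≈⟨ sum-hits c i (λ _ → 1#) ⟩
    size (hits? c i x) * sumOver (_∼? x) (λ _ → 1#)
      ≈⟨ *-congˡ (sum-cong-≋ λ y → *-identityʳ (𝟙 (y ∼? x))) ⟩
    size (hits? c i x) * size (_∼? x) ∎
    where
    open ≈-Reasoning ≈-setoid
    x = lookup (sc c) i

  module VarClass x = Average (_∼? x) (x , ∼.refl)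
  module ConClass c = Average (_≋? c) (c , ≋-refl ∼-equiv)

  -- By `size-≋`, the left side is also an inverse of the size of the variable class.
  weight-hits : ∀ c i →
    ConClass.weight c * size (hits? c i (lookup (sc c) i)) ≈ VarClass.weight (lookup (sc c) i)
  weight-hits c i = inverse-unique ≈-refl
    (≈-trans (*-assoc _ _ _) (≈-trans (*-congˡ (≈-sym (size-≋ c i))) (ConClass.weight*size c)))
    (VarClass.size*weight (lookup (sc c) i))

  module _ (v : Assignment) (feasible : IsFeasible v) where
    open Assignment v
    open IsFeasible feasible

    -- The junk value 0# has no effect: averages over the class of a constraint only
    -- involve constraints with the same relation.
    conAt : ∀ {R} c → Dec (rel c ≡ R) → Tuple d (arity R) → Carrier
    conAt c (yes refl) t = con c t
    conAt c (no _)     t = 0#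

    conAt-range : ∀ {R} c (r? : Dec (rel c ≡ R)) → rel c ≡ R → ∀ t → t ∈ tuples R →
                  InUnitInterval (conAt c r? t)
    conAt-range c (yes refl) p t t∈ = con-range c t t∈
    conAt-range c (no r≢R)   p      = contradiction p r≢R

    -- With the decision `r?` as an argument, matching identifies `R` with `rel c`; what remains is
    -- the marginal equation of `v`.
    conAt-marginal : ∀ {R} c (r? : Dec (rel c ≡ R)) (p : rel c ≡ R) i e →
      sum (λ t → 𝟙 ((t ∈? tuples R) ×-dec (t [ i ] ≟ e)) * conAt c r? t) ≈ var (varAt c p i) e
    conAt-marginal c (no r≢R)   p i e = contradiction p r≢R
    conAt-marginal c (yes refl) p i e rewrite Relation-uip p refl =
      ≈-trans (sum-cong-≋ λ t → ≈-sym (if≈𝟙* ((t ∈? tuples (rel c)) ×-dec (t [ i ] ≟ e)) _))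
              (x-y≈0⇒x≈y (marginal c i e))

    symmetrised : Assignment
    symmetrised = record
      { var = λ x e → VarClass.average x (λ y → var y e)
      ; con = λ c t → ConClass.average c (λ c′ → conAt c′ (rel c′ ≟ᴿ rel c) t)
      }

    -- The marginal of the average is the average of the marginals, each being `var` at the variable
    -- in position `i`. Grouping by that variable turns the average over the class of `c` into one
    -- over the class of `x`.
    symmetrised-marginal : ∀ c i e →
      sum (λ t → if does ((t ∈? tuples (rel c)) ×-dec (t [ i ] ≟ e))
                 then Assignment.con symmetrised c t else 0#)
      ≈ Assignment.var symmetrised (lookup (sc c) i) e
    symmetrised-marginal c i e = begin
      sum (λ t → if does (M? t) then Assignment.con symmetrised c t else 0#)
        ≈⟨ sum-cong-≋ (λ t → if≈𝟙* (M? t) _) ⟩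
      sum (λ t → 𝟙 (M? t) * ConClass.average c (λ c′ → value c′ t))
        ≈⟨ ConClass.average-comm c (𝟙 ∘ M?) (λ t c′ → value c′ t) ⟩
      ConClass.average c (λ c′ → sum (λ t → 𝟙 (M? t) * value c′ t))
        ≈⟨ *-congˡ (sum-cong-≋ λ c′ → hits-fibre c i c′ (λ y → var y e)
             (λ p → conAt-marginal c′ (rel c′ ≟ᴿ rel c) p i e)) ⟩
      ConClass.weight c * sum (λ c′ → sum (λ y → 𝟙 (hits? c i y c′) * var y e))
        ≈⟨ *-congˡ (sum-hits c i (λ y → var y e)) ⟩
      ConClass.weight c * (size (hits? c i x) * sumOver (_∼? x) (λ y → var y e))
        ≈⟨ *-assoc _ _ _ ⟨
      ConClass.weight c * size (hits? c i x) * sumOver (_∼? x) (λ y → var y e)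
        ≈⟨ *-congʳ (weight-hits c i) ⟩
      VarClass.average x (λ y → var y e) ∎
      where
      open ≈-Reasoning ≈-setoid
      x = lookup (sc c) i
      M? = λ t → (t ∈? tuples (rel c)) ×-dec (t [ i ] ≟ e)
      value = λ c′ t → conAt c′ (rel c′ ≟ᴿ rel c) t

    symmetrised-feasible : IsFeasible symmetrised
    symmetrised-feasible = record
      { var-range = λ x e → VarClass.average-range x λ y _ → var-range y e
      ; con-range = λ c t t∈ → ConClass.average-range c λ c′ (p , _) →
                      conAt-range c′ (rel c′ ≟ᴿ rel c) p t t∈
      -- Weights `1#` put the sum over the domain into the form of `average-comm`; the sums so
      -- averaged all equal `1#`.
      ; var-sum   = λ x → ≈-trans (sum-cong-≋ {d} λ e → ≈-sym (*-identityˡ _))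
                      (≈-trans (VarClass.average-comm x (λ _ → 1#) (λ e y → var y e))
                      (VarClass.average-const x λ y _ →
                        ≈-trans (sum-cong-≋ {d} λ e → *-identityˡ _) (var-sum y)))
      ; marginal  = λ c i e → ≈-trans (+-congʳ (symmetrised-marginal c i e)) (-‿inverseʳ _)
      }

    symmetrised-var-cong : ∀ {x x′} → x ∼ x′ → ∀ e →
      Assignment.var symmetrised x e ≈ Assignment.var symmetrised x′ e
    symmetrised-var-cong {x} {x′} x∼x′ e = average-⇔ (_∼? x) (_∼? x′) (x , ∼.refl) (x′ , ∼.refl)
      (λ y∼x → ∼.trans y∼x x∼x′) (λ y∼x′ → ∼.trans y∼x′ (∼.sym x∼x′)) (λ y → var y e)

-- Solutions constant on classes of iterated degree.

theorem3p2 :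
  ∀ {a ℓ₁ ℓ₂} (K : OrderedField a ℓ₁ ℓ₂) {d : ℕ}
    (Γ : ConstraintLanguage d) (I : Instance d) →
  let open OrderedField K using (_≈_)
      open Instance I using (Var)
      open BLP K I using (Feasible)
      open BLP K I using (IsFeasible)
      open BLP.Assignment using (var)
      open IteratedDegree I using (_∼δ_) in
  I ∈CSP Γ →
  Feasible →
  ∃[ v ] (IsFeasible v ×
    (∀ (x x′ : Var) → inj₁ x ∼δ inj₁ x′ →
     ∀ (e : Fin d) → var v x e ≈ var v x′ e))
theorem3p2 K Γ I _ (v , feasible) =
  symmetrised v feasible , symmetrised-feasible v feasible ,
  -- Equal degrees of order `m * 2` place both variables in one class of the stable stage `m`.
  λ x x′ x∼x′ → symmetrised-var-cong v feasible (δ⇒≈ m (x∼x′ (m ℕ.* 2)))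
  where
  open Refinement I
  m = proj₁ stable-stage
  open Symmetrisation K I (proj₁ (refinement m)) (proj₂ (refinement m)) (≈-isEquivalence m)
    -- By stability `x∼x′` also holds at stage `suc m`, whose second component is the equality of
    -- counts.
    (λ x∼x′ → proj₂ (proj₂ stable-stage x∼x′))
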